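{- Let $(W,S)$ be a finite Coxeter system. The map $\varphi$ defined below is a dimension-preserving bijection from the set of faces of the order complex of the BHZ poset $(W,\leq_\beta)$ (i.e. nonempty strict chains) to the set of faces of $\Delta(W)$; that is, it maps strict chains with $k$ elements bijectively onto the faces of $\Delta(W)$ with $k$ vertices, for every $k\geq 1$. Definition of $\varphi$: for a strict chain $e=u_1<_\beta u_2<_\beta\dots<_\beta u_k$ containing $e$, set $\varphi(u_1<_\beta\dots<_\beta u_k)=\{w_j\mid 1\leq j\leq k\}$ with $w_j=u_ku_j^{ -1}$ (equivalently $w_j=(u_k)^{S(u_j)}$). For a strict chain $u_1<_\beta\dots<_\beta u_k$ not containing $e$, set $\varphi(u_1<_\beta\dots<_\beta u_k)=\varphi(e<_\beta u_1<_\beta\dots<_\beta u_k)\setminus\{e\}$.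
   Context: $e$ is the identity and $\ell$ the length function. $D_R(w)=\{s\in S\mid \ell(ws)<\ell(w)\}$; $S(w)$ is the set of $s\in S$ appearing in some (equivalently any) reduced word for $w$. For $I\subseteq S$, $W_I$ is the standard parabolic subgroup generated by $I$, $w_{\circ,I}$ its longest element, $W^I=\{w\in W\mid D_R(w)\cap I=\emptyset\}$, and every $w$ factors uniquely as $w=w^Iw_I$ with $w^I\in W^I$, $w_I\in W_I$. BHZ order: $u\leq_\beta v$ iff $v_{S(u)}=u$. Right weak order: $u\leq_R v$ iff $\ell(u^{ -1}v)=\ell(v)-\ell(u)$. The $W$-permutahedron $\mathrm{Perm}(W)$ is the convex hull of the orbit $W\cdot x$ of a generic point $x$ in the space on which $W$ acts as a finite reflection group; its vertices are identified with $W$ via $w\mapsto w(x)$. Its faces are indexed by cosets $wW_I$ ($I\subseteq S$): the face $F_{wW_I}$ has dimension $\#I$ and vertex set $wW_I=[w^I,w^Iw_{\circ,I}]_R$, so each face has a unique minimal vertex $w^I$ for $\leq_R$. For a polytope $Q$ in which every face has a unique minimal vertex for a given order, the pulling triangulation of $Q$ is defined recursively: let $v$ be the minimal vertex of $Q$; take the pulling triangulations (with the restricted order) of all facets of $Q$ not containing $v$, and cone each of their simplices over $v$. $\Delta(W)$ is the pulling triangulation of $\mathrm{Perm}(W)$ with respect to the right weak order; its faces are identified with their vertex sets, which are subsets of $W$. -}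

module Defs where

open import Level using (0ℓ)
open import Data.Nat using (ℕ; zero; suc; _+_; _≤_; _<_)
open import Data.Fin using (Fin)
open import Data.List using (List; []; _∷_; length; foldr; map; filter)
open import Data.List.Membership.Propositional using (_∈_)
open import Data.List.Relation.Unary.All using (All)
open import Data.List.Relation.Unary.Linked using (Linked)
open import Data.List.Relation.Unary.Unique.Propositional using (Unique)
open import Data.Product using (Σ; ∃; ∃₂; _×_; _,_)
open import Data.Unit using (⊤)
open import Relation.Nullary using (¬_; ¬?)
open import Relation.Unary using (Pred)
open import Relation.Binary.Definitions using (DecidableEquality)
open import Relation.Binary.PropositionalEquality using (_≡_; _≢_)
open import Algebra.Bundles using (Group)

pow : {A : Set} → (A → A → A) → A → A → ℕ → A
pow _∙_ ε x zero    = ε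
pow _∙_ ε x (suc k) = x ∙ pow _∙_ ε x k

-- A finite Coxeter system (W,S), S = {gen s | s : Fin n}, given by its
-- Coxeter presentation <S | (st)^{m(s,t)} = e>, expressed via the universal
-- property of the presentation.
record CoxeterSystem : Set₁ where
  field
    W      : Set
    _·_    : W → W → W
    e      : W
    inv    : W → W
    assoc  : ∀ x y z → (x · y) · z ≡ x · (y · z)
    idˡ    : ∀ x → e · x ≡ x
    idʳ    : ∀ x → x · e ≡ x
    invˡ   : ∀ x → inv x · x ≡ e
    invʳ   : ∀ x → x · inv x ≡ e
    _≟_    : DecidableEquality W
    elems    : List W
    complete : ∀ x → x ∈ elems
    n          : ℕ
    gen        : Fin n → W
    gen-inj    : ∀ s t → gen s ≡ gen t → s ≡ t
    gen-nontriv : ∀ s → gen s ≢ e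
    m       : Fin n → Fin n → ℕ
    m-diag  : ∀ s → m s s ≡ 1
    m-sym   : ∀ s t → m s t ≡ m t s
    m-off   : ∀ s t → s ≢ t → 2 ≤ m s t
    rel     : ∀ s t → pow _·_ e (gen s · gen t) (m s t) ≡ e
    generates : ∀ x → ∃ λ (ws : List (Fin n)) → foldr (λ s y → gen s · y) e ws ≡ x
    universal : (G : Group 0ℓ 0ℓ) (f : Fin n → Group.Carrier G) →
      (∀ s t → Group._≈_ G (pow (Group._∙_ G) (Group.ε G) (Group._∙_ G (f s) (f t)) (m s t)) (Group.ε G)) →
      ∃ λ (h : W → Group.Carrier G) →
        (∀ x y → Group._≈_ G (h (x · y)) (Group._∙_ G (h x) (h y))) ×
        (∀ s → Group._≈_ G (h (gen s)) (f s))

module Theory (C : CoxeterSystem) where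
  open CoxeterSystem C

  Word : Set
  Word = List (Fin n)

  prod : Word → W
  prod = foldr (λ s y → gen s · y) e

  IsLength : W → ℕ → Set
  IsLength w k = (∃ λ ws → prod ws ≡ w × length ws ≡ k) × (∀ ws → prod ws ≡ w → k ≤ length ws)

  Reduced : Word → Set
  Reduced ws = ∀ ws′ → prod ws′ ≡ prod ws → length ws ≤ length ws′

  Supp : W → Pred (Fin n) 0ℓ
  Supp w s = ∃ λ ws → prod ws ≡ w × Reduced ws × s ∈ ws

  InParabolic : Pred (Fin n) 0ℓ → W → Set
  InParabolic I x = ∃ λ ws → All I ws × prod ws ≡ x

  RightDescent : W → Fin n → Set
  RightDescent x s = ∃₂ λ a b → IsLength (x · gen s) a × IsLength x b × a < b

  InMinCoset : Pred (Fin n) 0ℓ → W → Set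
  InMinCoset I x = ∀ s → I s → ¬ RightDescent x s

  -- BHZ order: v_{S(u)} = u, i.e. v = a · u with a ∈ W^{S(u)}, u ∈ W_{S(u)}
  _≤β_ : W → W → Set
  u ≤β v = ∃ λ a → InMinCoset (Supp u) a × InParabolic (Supp u) u × a · u ≡ v

  _<β_ : W → W → Set
  u <β v = u ≤β v × u ≢ v

  _≤R_ : W → W → Set
  u ≤R v = ∃₂ λ a b → ∃ λ c → IsLength (inv u · v) a × IsLength v b × IsLength u c × a + c ≡ b

  InCoset : W → Pred (Fin n) 0ℓ → W → Set
  InCoset x I y = InParabolic I (inv x · y)

  MinVertex : W → Pred (Fin n) 0ℓ → W → Set
  MinVertex x I v = InCoset x I v × (∀ y → InCoset x I y → v ≤R y)

  _minus_ : Pred (Fin n) 0ℓ → Fin n → Pred (Fin n) 0ℓ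
  (I minus s) t = I t × t ≢ s

  -- vertex sets of the maximal simplices of the pulling triangulation
  -- (w.r.t. ≤R) of the face F_{xW_I} of Perm(W).  Facets of F_{xW_I} are
  -- the faces F_{yW_{I∖s}} with s ∈ I and y ∈ xW_I.
  data PullSimplex : W → Pred (Fin n) 0ℓ → List W → Set₁ where
    point : ∀ {x I} → (∀ s → ¬ I s) → PullSimplex x I (x ∷ [])
    cone  : ∀ {x I v y s σ} → MinVertex x I v → I s → InCoset x I y →
            ¬ InCoset y (I minus s) v → PullSimplex y (I minus s) σ →
            PullSimplex x I (v ∷ σ)

  fullS : Pred (Fin n) 0ℓ
  fullS _ = ⊤

  _⊆_ : List W → List W → Set
  A ⊆ B = ∀ x → x ∈ A → x ∈ B

  SameSet : List W → List W → Set
  SameSet A B = A ⊆ B × B ⊆ A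

  IsFaceΔ : List W → Set₁
  IsFaceΔ F = F ≢ [] × Unique F × ∃ λ σ → PullSimplex e fullS σ × F ⊆ σ

  IsChain : List W → Set
  IsChain c = c ≢ [] × Linked _<β_ c

  lastOf : W → List W → W
  lastOf x []       = x
  lastOf x (y ∷ ys) = lastOf y ys

  φe : List W → List W
  φe []       = []
  φe (u ∷ us) = map (λ x → lastOf u us · inv x) (u ∷ us)

  φ : List W → List W
  φ [] = []
  φ (u ∷ us) with u ≟ e
  ... | Relation.Nullary.yes _ = φe (u ∷ us)
  ... | Relation.Nullary.no  _ = filter (λ x → ¬? (x ≟ e)) (φe (e ∷ u ∷ us))

{-# OPTIONS --safe #-}

-- W acts on the functions W → 𝔽₂ by conjugation, and the universal property of
-- the presentation, applied to the semidirect product, yields a cocycle η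
-- recording which reflections are left inversions of w.  This gives the strong
-- exchange condition, and with it well-definedness of supports and
-- ℓ (a b) = ℓ a + ℓ b for a ∈ W^I, b ∈ W_I.
--
-- A simplex of Δ(W) is a list v₁ = e, …, v_r whose cosets v_i W_{J_i} are nested
-- and have minimal vertex v_i; sublists keep this property, and the elements
-- v_i⁻¹ v_r then form a chain for ≤β, since v_i⁻¹ v_{i+1} ∈ W^{J_{i+1}} and
-- S(v_{i+1}⁻¹ v_r) ⊆ J_{i+1}.  Conversely a chain u_k > … > u_1 in W_J is placed
-- into a simplex of x W_J, starting from the top, by induction on the size of J.
-- φ is injective because φ(c), as a list, is strictly sorted by length.

module Submission where

open import Defs
open import Level using (Level; 0ℓ)
open import Algebra.Bundles using (Group)
import Algebra.Properties.Group as GroupProperties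
open import Data.Bool using (Bool; true; false; not; _xor_)
open import Data.Bool.Properties using (xor-assoc; xor-comm; xor-same; xor-identityʳ)
open import Data.Empty using (⊥-elim)
open import Data.Fin using (Fin)
import Data.Fin.Properties as Fin
open import Data.List using (List; []; _∷_; _++_; _∷ʳ_; length; initLast; _∷ʳ′_; map; filter; allFin; reverse; foldl)
open import Data.List.Properties using (length-++; filter-++; filter-all; filter-reject; filter-notAll; length-map; reverse-involutive; map-injective; ∷-injective; ++-identityʳ)
open import Data.List.Membership.Propositional using (_∈_)
open import Data.List.Membership.Propositional.Properties using (∈-++⁺ˡ; ∈-++⁺ʳ; ∈-map⁺; ∈-map⁻; ∈-filter⁺; ∈-filter⁻; ∈-allFin; ∈-length)
open import Data.List.Membership.Propositional.Properties.WithK using (unique∧set⇒bag)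
import Data.List.Membership.DecPropositional as DecMembership
open import Data.List.Relation.Binary.BagAndSetEquality using (∼bag⇒↭)
open import Data.List.Relation.Binary.Permutation.Propositional.Properties using (↭-length)
open import Data.List.Relation.Unary.All as All using (All; []; _∷_)
import Data.List.Relation.Unary.All.Properties as All
open import Data.List.Relation.Unary.AllPairs as AllPairs using (AllPairs; []; _∷_)
import Data.List.Relation.Unary.AllPairs.Properties as AllPairs
open import Data.List.Relation.Unary.Any as Any using (here; there)
import Data.List.Relation.Unary.Any.Properties as Any
open import Data.List.Relation.Unary.Linked using (Linked; []; [-]; _∷_)
import Data.List.Relation.Unary.Linked.Properties as Linked
open import Data.List.Relation.Unary.Unique.Propositional using (Unique)
open import Data.Nat using (ℕ; zero; suc; _+_; _≤_; _<_; s≤s)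
open import Data.Nat.Induction using (<-wellFounded)
open import Data.Nat.Properties hiding (_≟_)
open import Data.Product using (∃; ∃₂; _×_; _,_; proj₁; proj₂)
open import Data.Sum using (_⊎_; inj₁; inj₂)
open import Data.Unit using (tt)
open import Function using (_∘_; flip; mk⇔)
open import Induction.WellFounded using (Acc; acc)
open import Relation.Binary using (Rel; Asymmetric)
open import Relation.Binary.PropositionalEquality
open import Relation.Nullary using (¬_; ¬?; Dec; yes; no; does; contradiction)
open import Relation.Nullary.Decidable using (does-⇔; dec-true; dec-false; map′; _×-dec_)
open import Relation.Unary using (Pred; Decidable)

-- Least witnesses and sorted lists.

least : {P : Pred ℕ 0ℓ} → Decidable P → ∀ k → P k → ∃ λ j → P j × (∀ i → P i → j ≤ i)
least {P} P? k = go k (<-wellFounded k)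
  where
  go : ∀ k → Acc _<_ k → P k → ∃ λ j → P j × (∀ i → P i → j ≤ i)
  go k (acc rec) pk with anyUpTo? P? k
  ... | yes (j , j<k , pj) = go j (rec j<k) pj
  ... | no none = k , pk , λ i pi → ≮⇒≥ (λ i<k → none (i , i<k , pi))

module _ {a : Level} {A : Set a} where

  Linked-reverse : {R : Rel A 0ℓ} {xs : List A} → Linked R xs → Linked (flip R) (reverse xs)
  Linked-reverse {R} {[]} [] = []
  Linked-reverse {R} {x ∷ xs} linked = go x [] xs [-] linked
    where
    go : ∀ x rev xs → Linked (flip R) (x ∷ rev) → Linked R (x ∷ xs) → Linked (flip R) (foldl (flip _∷_) (x ∷ rev) xs)
    go x rev [] done [-] = done
    go x rev (y ∷ xs) done (Rxy ∷ todo) = go y (x ∷ rev) xs (Rxy ∷ done) todo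

  AllPairs-∷ʳ⁻ : {R : Rel A 0ℓ} (xs : List A) {y : A} → AllPairs R (xs ∷ʳ y) → All (λ x → R x y) xs
  AllPairs-∷ʳ⁻ [] _ = []
  AllPairs-∷ʳ⁻ (x ∷ xs) (Rx ∷ pairs) = proj₂ (All.∷ʳ⁻ Rx) ∷ AllPairs-∷ʳ⁻ xs pairs

  -- If the heads differed, each would occur in the tail of the other list and the two would be
  -- related both ways. This turns equality of vertex sets into equality of lists.
  sorted-unique : {R : Rel A 0ℓ} → Asymmetric R → {xs ys : List A} → AllPairs R xs → AllPairs R ys →
    (∀ x → x ∈ xs → x ∈ ys) → (∀ x → x ∈ ys → x ∈ xs) → xs ≡ ys
  sorted-unique asym [] [] _ _ = refl
  sorted-unique asym [] (_∷_ {x = y} _ _) _ sup with sup y (here refl)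
  ... | ()
  sorted-unique asym (_∷_ {x = x} _ _) [] sub _ with sub x (here refl)
  ... | ()
  sorted-unique {R} asym {x ∷ xs} {y ∷ ys} (Rx ∷ pxs) (Ry ∷ pys) sub sup = cong₂ _∷_ x≡y
    (sorted-unique asym pxs pys
      (λ z z∈xs → drop (sub z (there z∈xs)) (λ z≡y → irr (All.lookup Rx z∈xs) (trans x≡y (sym z≡y))))
      (λ z z∈ys → drop (sup z (there z∈ys)) (λ z≡x → irr (All.lookup Ry z∈ys) (trans (sym x≡y) (sym z≡x)))))
    where
    x≡y : x ≡ y
    x≡y with sub x (here refl) | sup y (here refl)
    ... | here eq | _ = eq
    ... | there _ | here eq = sym eq
    ... | there x∈ys | there y∈xs = contradiction (All.lookup Ry x∈ys) (asym (All.lookup Rx y∈xs))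
    irr : ∀ {u v} → R u v → u ≢ v
    irr Ruu refl = asym Ruu Ruu
    drop : ∀ {z w ws} → z ∈ w ∷ ws → z ≢ w → z ∈ ws
    drop (here eq) z≢w = contradiction eq z≢w
    drop (there z∈ws) _ = z∈ws

  unique-length : {xs ys : List A} → Unique xs → Unique ys →
    (∀ x → x ∈ xs → x ∈ ys) → (∀ x → x ∈ ys → x ∈ xs) → length xs ≡ length ys
  unique-length uxs uys sub sup = ↭-length (∼bag⇒↭ (unique∧set⇒bag uxs uys (mk⇔ (sub _) (sup _))))

module Coxeter (C : CoxeterSystem) where
  open CoxeterSystem C
  open Theory C

  -- The reflection cocycle.

  W-group : Group 0ℓ 0ℓ
  W-group = record
    { Carrier = W ; _≈_ = _≡_ ; _∙_ = _·_ ; ε = e ; _⁻¹ = inv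
    ; isGroup = record
      { isMonoid = record
        { isSemigroup = record
          { isMagma = record { isEquivalence = isEquivalence ; ∙-cong = cong₂ _·_ }
          ; assoc = assoc }
        ; identity = idˡ , idʳ }
      ; inverse = invˡ , invʳ
      ; ⁻¹-cong = cong inv } }

  open GroupProperties W-group public
    using (∙-cancelˡ; ∙-cancelʳ; inverseˡ-unique; identityˡ-unique; identityʳ-unique)
    renaming (\\-leftDividesˡ to ·-inv-·; \\-leftDividesʳ to inv-·-·; ε⁻¹≈ε to inv-e;
              ⁻¹-involutive to inv-inv; ⁻¹-anti-homo-∙ to inv-·; ⁻¹-injective to inv-injective)

  conj : W → W → W
  conj w t = inv w · (t · w)

  conj-e : ∀ t → conj e t ≡ t
  conj-e t rewrite inv-e | idʳ t = idˡ t

  conj-· : ∀ w v t → conj (w · v) t ≡ conj v (conj w t)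
  conj-· w v t rewrite inv-· w v | assoc (inv v) (inv w) (t · (w · v))
    | assoc (inv w) (t · w) v | assoc t w v = refl

  -- The semidirect product of W with the W-module of functions W → 𝔽₂.
  cocycle-group : Group 0ℓ 0ℓ
  cocycle-group = record
    { Carrier = (W → Bool) × W
    ; _≈_ = λ x y → (∀ t → proj₁ x t ≡ proj₁ y t) × proj₂ x ≡ proj₂ y
    ; _∙_ = mul
    ; ε = (λ _ → false) , e
    ; _⁻¹ = λ (f , w) → (λ t → f (conj (inv w) t)) , inv w
    ; isGroup = record
      { isMonoid = record
        { isSemigroup = record
          { isMagma = record
            { isEquivalence = record
              { refl = (λ _ → refl) , refl
              ; sym = λ (p , q) → (λ t → sym (p t)) , sym q
              ; trans = λ (p , q) (p′ , q′) → (λ t → trans (p t) (p′ t)) , trans q q′ }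
            ; ∙-cong = λ { (p , refl) (p′ , refl) → (λ t → cong₂ _xor_ (p t) (p′ _)) , refl } }
          ; assoc = λ (f , w) (g , v) (h , u) →
              (λ t → trans (xor-assoc (f t) _ _) (cong (λ z → f t xor (g (conj w t) xor h z)) (conj-· w v t))) ,
              assoc w v u }
        ; identity = (λ (f , w) → (λ t → cong f (conj-e t)) , idˡ w) ,
                     (λ (f , w) → (λ t → xor-identityʳ (f t)) , idʳ w) }
      ; inverse = (λ (f , w) → (λ t → xor-same (f (conj (inv w) t))) , invˡ w) ,
                  (λ (f , w) → (λ t → trans (cong (λ z → f t xor f z) (conj-conj-inv w t)) (xor-same (f t))) , invʳ w)
      ; ⁻¹-cong = λ { (p , refl) → (λ t → p _) , refl } } }
    where
    mul : (W → Bool) × W → (W → Bool) × W → (W → Bool) × W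
    mul (f , w) (g , v) = (λ t → f t xor g (conj w t)) , w · v
    conj-conj-inv : ∀ w t → conj (inv w) (conj w t) ≡ t
    conj-conj-inv w t = trans (sym (conj-· w (inv w) t)) (trans (cong (λ z → conj z t) (invʳ w)) (conj-e t))

  δ : W → W → Bool
  δ x t = does (t ≟ x)

  δ-cong : ∀ {x t y u} → (t ≡ x → u ≡ y) → (u ≡ y → t ≡ x) → δ x t ≡ δ y u
  δ-cong f g = does-⇔ (mk⇔ f g) (_ ≟ _) (_ ≟ _)

  gen-invol : ∀ s → gen s · gen s ≡ e
  gen-invol s with rel s s
  ... | r rewrite m-diag s = trans (sym (idʳ _)) r

  inv-gen : ∀ s → inv (gen s) ≡ gen s
  inv-gen s = sym (inverseˡ-unique _ _ (gen-invol s))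

  gen-gen-· : ∀ s x → gen s · (gen s · x) ≡ x
  gen-gen-· s x = trans (sym (assoc _ _ _)) (trans (cong (_· x) (gen-invol s)) (idˡ x))

  conj-≡ : ∀ w t x → conj w t ≡ x → t ≡ w · (x · inv w)
  conj-≡ w t x refl rewrite assoc (inv w) (t · w) (inv w) | ·-inv-· w ((t · w) · inv w)
    | assoc t w (inv w) | invʳ w = sym (idʳ t)

  conj-≡⁻ : ∀ w t x → t ≡ w · (x · inv w) → conj w t ≡ x
  conj-≡⁻ w t x refl rewrite assoc w (x · inv w) w | inv-·-· w ((x · inv w) · w)
    | assoc x (inv w) w | invˡ w = idʳ x

  -- (s t)^k s for k = 0, 1, 2, … are the reflections attached to the word
  -- s t s t …; over a full period of length 2m each of them occurs twice.
  module Dihedral (s t : Fin n) where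
    p : W
    p = gen s · gen t

    f : Fin n → (W → Bool) × W
    f u = δ (gen u) , gen u

    open Group cocycle-group using (_∙_; ε; _≈_)

    pow-comm : ∀ j → pow _·_ e p j · p ≡ p · pow _·_ e p j
    pow-comm zero = trans (idˡ p) (sym (idʳ p))
    pow-comm (suc j) = trans (assoc _ _ _) (cong (p ·_) (pow-comm j))

    -- The parity of the number of `j < k` for which `x` is the `j`-th power of `p` times `q`.
    run : ℕ → W → W → Bool
    run zero    q x = false
    run (suc k) q x = δ q x xor run k (p · q) x

    run-+ : ∀ j k q x → run (j + k) q x ≡ run j q x xor run k (pow _·_ e p j · q) x
    run-+ zero k q x rewrite idˡ q = refl
    run-+ (suc j) k q x = trans (cong (δ q x xor_) (run-+ j k (p · q) x))
      (trans (sym (xor-assoc (δ q x) (run j (p · q) x) _))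
             (cong (λ z → (δ q x xor run j (p · q) x) xor run k z x)
                   (trans (sym (assoc _ _ _)) (cong (_· q) (pow-comm j)))))

    -- Holds for powers of `p` times `gen s`, because `s` inverts `p` under conjugation. It turns
    -- conjugation by `p` into left multiplication by the square of `p`.
    twisted : W → Set
    twisted q = q · inv p ≡ p · q

    twisted-gen : twisted (gen s)
    twisted-gen rewrite inv-· (gen s) (gen t) | inv-gen s | inv-gen t = sym (assoc _ _ _)

    twisted-step : ∀ {q} → twisted q → twisted (p · q)
    twisted-step tw = trans (assoc _ _ _) (cong (p ·_) tw)

    run-conj : ∀ k q → twisted q → ∀ x → run k q (conj p x) ≡ run k (p · (p · q)) x
    run-conj zero q tw x = refl
    run-conj (suc k) q tw x = cong₂ _xor_
      (δ-cong (λ eq → trans (conj-≡ p x q eq) (cong (p ·_) tw))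
              (λ eq → conj-≡⁻ p x q (trans eq (cong (p ·_) (sym tw)))))
      (run-conj k (p · q) (twisted-step tw) x)

    -- The factor `f s ∙ f t` contributes the first two reflections, `gen s` and `p · gen s`;
    -- twisting the remaining factors by `p` moves their run two places on.
    pow-run : ∀ k → pow _∙_ ε (f s ∙ f t) k ≈ (run (k + k) (gen s) , pow _·_ e p k)
    pow-run zero = (λ _ → refl) , refl
    pow-run (suc k) with pow-run k
    ... | ih₁ , ih₂ = (λ x → trans (lhs x) (cong (λ j → δ (gen s) x xor run j (p · gen s) x) (sym (+-suc k k)))) , cong (p ·_) ih₂
      where
      lhs : ∀ x → (δ (gen s) x xor δ (gen t) (conj (gen s) x)) xor proj₁ (pow _∙_ ε (f s ∙ f t) k) (conj p x)
                ≡ run (suc (suc (k + k))) (gen s) x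
      lhs x rewrite ih₁ (conj p x) | run-conj (k + k) (gen s) twisted-gen x
        | δ-cong {gen t} {conj (gen s) x} {p · gen s} {x}
            (λ eq → trans (conj-≡ (gen s) x (gen t) eq) (trans (cong (λ z → gen s · (gen t · z)) (inv-gen s)) (sym (assoc _ _ _))))
            (λ eq → conj-≡⁻ (gen s) x (gen t) (trans eq (trans (assoc _ _ _) (cong (λ z → gen s · (gen t · z)) (sym (inv-gen s))))))
        = xor-assoc (δ (gen s) x) _ _

    relation : pow _∙_ ε (f s ∙ f t) (m s t) ≈ ε
    relation with pow-run (m s t)
    ... | eq₁ , eq₂ = (λ x → trans (eq₁ x) (period x)) , trans eq₂ (rel s t)
      where
      period : ∀ x → run (m s t + m s t) (gen s) x ≡ false
      period x rewrite run-+ (m s t) (m s t) (gen s) x | rel s t | idˡ (gen s) = xor-same (run (m s t) (gen s) x)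

  cocycle : ∃ λ (η : W → W → Bool) → (∀ w v t → η (w · v) t ≡ η w t xor η v (conj w t)) × (∀ s t → η (gen s) t ≡ δ (gen s) t)
  cocycle with universal cocycle-group (λ s → δ (gen s) , gen s) Dihedral.relation
  ... | h , hom , on-gen = (λ w → proj₁ (h w)) ,
        (λ w v t → trans (proj₁ (hom w v) t) (cong (λ z → proj₁ (h w) t xor proj₁ (h v) (conj z t)) (h₂ w))) ,
        (λ s → proj₁ (on-gen s))
    where
    -- A multiplicative map sends `e` to an idempotent, hence to `e`; fixing the generators, the
    -- `W`-component is then the identity.
    h₂-e : proj₂ (h e) ≡ e
    h₂-e = identityʳ-unique _ _ (trans (sym (proj₂ (hom e e))) (cong (proj₂ ∘ h) (idˡ e)))
    h₂-prod : ∀ ws → proj₂ (h (prod ws)) ≡ prod ws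
    h₂-prod [] = h₂-e
    h₂-prod (s ∷ ws) = trans (proj₂ (hom _ _)) (cong₂ _·_ (proj₂ (on-gen s)) (h₂-prod ws))
    h₂ : ∀ w → proj₂ (h w) ≡ w
    h₂ w with generates w
    ... | ws , refl = h₂-prod ws

  -- η w t is true iff the reflection t is a left inversion of w.
  abstract
    η : W → W → Bool
    η = proj₁ cocycle

    η-· : ∀ w v t → η (w · v) t ≡ η w t xor η v (conj w t)
    η-· = proj₁ (proj₂ cocycle)

    η-gen : ∀ s t → η (gen s) t ≡ δ (gen s) t
    η-gen = proj₂ (proj₂ cocycle)

  -- Exchange and the length function.

  η-gen-self : ∀ s → η (gen s) (gen s) ≡ true
  η-gen-self s = trans (η-gen s (gen s)) (dec-true (gen s ≟ gen s) refl)

  η-e : ∀ t → η e t ≡ false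
  η-e t with η-· e e t
  ... | eq rewrite idˡ e | conj-e t = trans eq (xor-same (η e t))

  -- The cocycle identity read along the word: if `t` is the first letter, that letter is deleted;
  -- otherwise the value `true` passes to the tail, with `t` conjugated. The last clause records
  -- that only letters of `ws` are used.
  exchange : ∀ ws t → η (prod ws) t ≡ true →
    ∃ λ ws′ → prod ws′ ≡ t · prod ws × suc (length ws′) ≡ length ws ×
              (∀ {I : Pred (Fin n) 0ℓ} → All I ws → All I ws′)
  exchange [] t η-true with trans (sym (η-e t)) η-true
  ... | ()
  exchange (s ∷ ws) t η-true with t ≟ gen s
  ... | yes refl = ws , sym (gen-gen-· s (prod ws)) , refl , λ { (_ ∷ all) → all }
  ... | no t≢s with exchange ws (conj (gen s) t) η-tail
    where
    η-tail : η (prod ws) (conj (gen s) t) ≡ true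
    η-tail with η-· (gen s) (prod ws) t
    ... | eq rewrite η-gen s t | dec-false (t ≟ gen s) t≢s = trans (sym eq) η-true
  ... | ws′ , prod≡ , len , sub = s ∷ ws′ , prod-eq , cong suc len , λ { (px ∷ all) → px ∷ sub all }
    where
    prod-eq : gen s · prod ws′ ≡ t · (gen s · prod ws)
    prod-eq rewrite prod≡ | inv-gen s | assoc (gen s) (t · gen s) (prod ws) | gen-gen-· s ((t · gen s) · prod ws)
      = assoc _ _ _

  Expressible : W → ℕ → Set
  Expressible w k = ∃ λ ws → prod ws ≡ w × length ws ≡ k

  -- Search on the first letter. Decidability is what lets `least` produce the length.
  expressible? : ∀ k w → Dec (Expressible w k)
  expressible? zero w = map′ (λ { refl → [] , refl , refl }) (λ { ([] , eq , _) → sym eq }) (w ≟ e)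
  expressible? (suc k) w = map′
    (λ { (s , ws , eq , len) → s ∷ ws , trans (cong (gen s ·_) eq) (gen-gen-· s w) , cong suc len })
    (λ { (s ∷ ws , refl , len) → s , ws , sym (gen-gen-· s _) , suc-injective len })
    (Fin.any? (λ s → expressible? k (gen s · w)))

  abstract
    length-exists : ∀ w → ∃ (IsLength w)
    length-exists w with generates w
    ... | ws₀ , eq₀ with least (λ k → expressible? k w) (length ws₀) (ws₀ , eq₀ , refl)
    ... | k , ex , min = k , ex , λ ws eq → min (length ws) (ws , eq , refl)

  ℓ : W → ℕ
  ℓ w = proj₁ (length-exists w)

  ℓ-isLength : ∀ w → IsLength w (ℓ w)
  ℓ-isLength w = proj₂ (length-exists w)

  ℓ-≤ : ∀ ws → ℓ (prod ws) ≤ length ws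
  ℓ-≤ ws = proj₂ (ℓ-isLength (prod ws)) ws refl

  isLength-≡ : ∀ {w k} → IsLength w k → k ≡ ℓ w
  isLength-≡ {w} ((ws , eq , refl) , min) with ℓ-isLength w
  ... | (ws′ , eq′ , len′) , min′ = ≤-antisym (≤-trans (min ws′ eq′) (≤-reflexive len′)) (min′ ws eq)

  reducedWord : ∀ w → ∃ λ ws → prod ws ≡ w × length ws ≡ ℓ w
  reducedWord w = proj₁ (ℓ-isLength w)

  ℓ-e : ℓ e ≡ 0
  ℓ-e = n≤0⇒n≡0 (ℓ-≤ [])

  ℓ≡0⇒e : ∀ {w} → ℓ w ≡ 0 → w ≡ e
  ℓ≡0⇒e {w} eq with reducedWord w
  ... | [] , refl , _ = refl
  ... | _ ∷ _ , _ , len with trans len eq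
  ... | ()

  e≢⇒ℓ>0 : ∀ {w} → w ≢ e → 0 < ℓ w
  e≢⇒ℓ>0 w≢e = n≢0⇒n>0 (w≢e ∘ ℓ≡0⇒e)

  prod-++ : ∀ ws vs → prod (ws ++ vs) ≡ prod ws · prod vs
  prod-++ [] vs = sym (idˡ _)
  prod-++ (s ∷ ws) vs = trans (cong (gen s ·_) (prod-++ ws vs)) (sym (assoc _ _ _))

  ℓ-·-≤ : ∀ x y → ℓ (x · y) ≤ ℓ x + ℓ y
  ℓ-·-≤ x y with reducedWord x | reducedWord y
  ... | ws , refl , len | vs , refl , len′ = begin
    ℓ (prod ws · prod vs)  ≡⟨ cong ℓ (prod-++ ws vs) ⟨
    ℓ (prod (ws ++ vs))    ≤⟨ ℓ-≤ (ws ++ vs) ⟩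
    length (ws ++ vs)      ≡⟨ length-++ ws ⟩
    length ws + length vs  ≡⟨ cong₂ _+_ len len′ ⟩
    ℓ (prod ws) + ℓ (prod vs) ∎
    where open ≤-Reasoning

  η-true⇒< : ∀ {w t} → η w t ≡ true → ℓ (t · w) < ℓ w
  η-true⇒< {w} {t} η-true with reducedWord w
  ... | ws , refl , len with exchange ws t η-true
  ... | ws′ , eq , len′ , _ = begin
    suc (ℓ (t · prod ws))  ≡⟨ cong (suc ∘ ℓ) eq ⟨
    suc (ℓ (prod ws′))     ≤⟨ s≤s (ℓ-≤ ws′) ⟩
    suc (length ws′)       ≡⟨ len′ ⟩
    length ws              ≡⟨ len ⟩
    ℓ (prod ws)            ∎
    where open ≤-Reasoning

  -- The reflection acting on `w` from the left as `s` does from the right; through it `η`, which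
  -- records left inversions, detects right descents.
  refl-of : W → Fin n → W
  refl-of w s = w · (gen s · inv w)

  refl-of-· : ∀ w s → refl-of w s · w ≡ w · gen s
  refl-of-· w s rewrite assoc w (gen s · inv w) w | assoc (gen s) (inv w) w | invˡ w | idʳ (gen s) = refl

  -- Conjugation by `w` carries this reflection to `gen s`, where `η (gen s)` is `true`, so the
  -- cocycle identity flips the value.
  η-·gen : ∀ w s → η (w · gen s) (refl-of w s) ≡ not (η w (refl-of w s))
  η-·gen w s rewrite η-· w (gen s) (refl-of w s) | conj-≡⁻ w (refl-of w s) (gen s) refl | η-gen-self s
    = xor-comm (η w (refl-of w s)) true

  gen-cancelʳ : ∀ w s → (w · gen s) · gen s ≡ w
  gen-cancelʳ w s = trans (assoc _ _ _) (trans (cong (w ·_) (gen-invol s)) (idʳ w))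

  refl-of-·gen : ∀ w s → refl-of w s · (w · gen s) ≡ w
  refl-of-·gen w s = trans (sym (assoc _ _ _)) (trans (cong (_· gen s) (refl-of-· w s)) (gen-cancelʳ w s))

  η-false⇒< : ∀ {w s} → η w (refl-of w s) ≡ false → ℓ w < ℓ (w · gen s)
  η-false⇒< {w} {s} η-false = subst (λ z → ℓ z < ℓ (w · gen s)) (refl-of-·gen w s)
    (η-true⇒< (trans (η-·gen w s) (cong not η-false)))

  ascent⇒η : ∀ {w s} → ℓ w < ℓ (w · gen s) → η w (refl-of w s) ≡ false
  ascent⇒η {w} {s} lt with η w (refl-of w s) in eq
  ... | false = refl
  ... | true = contradiction lt (<-asym (subst (λ z → ℓ z < ℓ w) (refl-of-· w s) (η-true⇒< eq)))

  left-η-false⇒< : ∀ {w s} → η w (gen s) ≡ false → ℓ w < ℓ (gen s · w)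
  left-η-false⇒< {w} {s} η-false = subst (λ z → ℓ z < ℓ (gen s · w)) (gen-gen-· s w) (η-true⇒< η-sw)
    where
    η-sw : η (gen s · w) (gen s) ≡ true
    η-sw rewrite η-· (gen s) w (gen s) | η-gen-self s | gen-invol s | idʳ (inv (gen s)) | inv-gen s | η-false = refl

  left-descent⇒η : ∀ {w s} → ℓ (gen s · w) < ℓ w → η w (gen s) ≡ true
  left-descent⇒η {w} {s} lt with η w (gen s) in eq
  ... | true = refl
  ... | false = contradiction lt (<-asym (left-η-false⇒< eq))

  descent⇒< : ∀ {x s} → RightDescent x s → ℓ (x · gen s) < ℓ x
  descent⇒< (a , b , len-a , len-b , a<b) = subst₂ _<_ (isLength-≡ len-a) (isLength-≡ len-b) a<b

  <⇒descent : ∀ {x s} → ℓ (x · gen s) < ℓ x → RightDescent x s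
  <⇒descent {x} {s} lt = _ , _ , ℓ-isLength (x · gen s) , ℓ-isLength x , lt

  -- Parabolic subgroups, reduced words and supports.

  par-e : ∀ {I} → InParabolic I e
  par-e = [] , [] , refl

  par-gen : ∀ {I s} → I s → InParabolic I (gen s)
  par-gen {s = s} Is = s ∷ [] , Is ∷ [] , idʳ (gen s)

  par-· : ∀ {I x y} → InParabolic I x → InParabolic I y → InParabolic I (x · y)
  par-· (ws , all , refl) (vs , all′ , refl) = ws ++ vs , All.++⁺ all all′ , prod-++ ws vs

  par-inv : ∀ {I x} → InParabolic I x → InParabolic I (inv x)
  par-inv ([] , [] , refl) = subst (InParabolic _) (sym inv-e) par-e
  par-inv {I} (s ∷ ws , Is ∷ all , refl) =
    subst (InParabolic I) (sym (trans (inv-· (gen s) (prod ws)) (cong (inv (prod ws) ·_) (inv-gen s))))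
      (par-· (par-inv (ws , all , refl)) (par-gen Is))

  par-mono : ∀ {I J : Pred (Fin n) 0ℓ} {x} → (∀ s → I s → J s) → InParabolic I x → InParabolic J x
  par-mono sub (ws , all , eq) = ws , All.map (sub _) all , eq

  ℓ-gen· : ∀ s w → ℓ (gen s · w) ≤ suc (ℓ w)
  ℓ-gen· s w with reducedWord w
  ... | ws , refl , len = subst (λ k → ℓ (prod (s ∷ ws)) ≤ suc k) len (ℓ-≤ (s ∷ ws))

  ℓ-gen : ∀ s → ℓ (gen s) ≤ 1
  ℓ-gen s = subst (λ z → ℓ z ≤ 1) (idʳ (gen s)) (ℓ-≤ (s ∷ []))

  ℓ-·gen : ∀ w s → ℓ w ≤ suc (ℓ (w · gen s))
  ℓ-·gen w s = begin
    ℓ w                           ≡⟨ cong ℓ (gen-cancelʳ w s) ⟨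
    ℓ ((w · gen s) · gen s)       ≤⟨ ℓ-·-≤ (w · gen s) (gen s) ⟩
    ℓ (w · gen s) + ℓ (gen s)     ≤⟨ +-monoʳ-≤ _ (ℓ-gen s) ⟩
    ℓ (w · gen s) + 1             ≡⟨ +-comm _ 1 ⟩
    suc (ℓ (w · gen s))           ∎
    where open ≤-Reasoning

  -- Induction on the word. A new first letter either raises the length and is kept, or exchange
  -- cancels it against a letter of the reduced word for the tail.
  par-reduced : ∀ {I w} → InParabolic I w → ∃ λ ws → All I ws × prod ws ≡ w × length ws ≡ ℓ w
  par-reduced ([] , [] , refl) = [] , [] , refl , sym ℓ-e
  par-reduced (s ∷ ws , Is ∷ all , refl) with par-reduced (ws , all , refl)
  ... | vs , all′ , eq , len with η (prod ws) (gen s) in η-eq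
  ... | false = s ∷ vs , Is ∷ all′ , cong (gen s ·_) eq ,
        ≤-antisym (≤-trans (s≤s (≤-reflexive len)) (left-η-false⇒< η-eq))
                  (subst (λ z → ℓ (gen s · z) ≤ suc (length vs)) eq (ℓ-≤ (s ∷ vs)))
  ... | true with exchange vs (gen s) (trans (cong (λ z → η z (gen s)) eq) η-eq)
  ... | us , eq′ , len′ , sub = us , sub all′ , prod-us ,
        ≤-antisym (≤-pred (≤-trans (≤-reflexive (trans len′ len)) ℓ-le)) (subst (λ z → ℓ z ≤ length us) prod-us (ℓ-≤ us))
    where
    prod-us : prod us ≡ gen s · prod ws
    prod-us = trans eq′ (cong (gen s ·_) eq)
    ℓ-le : ℓ (prod ws) ≤ suc (ℓ (gen s · prod ws))
    ℓ-le = subst (λ z → ℓ z ≤ suc (ℓ (gen s · prod ws))) (gen-gen-· s _) (ℓ-gen· s (gen s · prod ws))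

  par-gen⁻ : ∀ {I s} → InParabolic I (gen s) → I s
  par-gen⁻ {I} {s} par with par-reduced par
  ... | [] , _ , eq , _ = contradiction (sym eq) (gen-nontriv s)
  ... | t ∷ [] , It ∷ [] , eq , _ = subst I (gen-inj t s (trans (sym (idʳ (gen t))) eq)) It
  ... | _ ∷ _ ∷ _ , _ , _ , len with subst (_≤ 1) (sym len) (ℓ-gen s)
  ... | s≤s ()

  reduced⇒ℓ : ∀ ws → Reduced ws → length ws ≡ ℓ (prod ws)
  reduced⇒ℓ ws red with reducedWord (prod ws)
  ... | vs , eq , len = ≤-antisym (≤-trans (red vs eq) (≤-reflexive len)) (ℓ-≤ ws)

  ℓ⇒reduced : ∀ ws → length ws ≤ ℓ (prod ws) → Reduced ws
  ℓ⇒reduced ws len vs eq = ≤-trans len (subst (λ z → ℓ z ≤ length vs) eq (ℓ-≤ vs))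

  -- The first letter `s` is a left descent, so exchange in the word `vs` puts the tail into W_I; as
  -- a quotient of two elements of W_I, `gen s` lies there too. Hence supports do not depend on the
  -- reduced word.
  par⇒letters : ∀ {I} ws → length ws ≤ ℓ (prod ws) → InParabolic I (prod ws) → All I ws
  par⇒letters [] _ _ = []
  par⇒letters {I} (s ∷ ws) len par@(vs , all , eq) = par-gen⁻ par-s ∷ par⇒letters ws len′ par′
    where
    len′ : length ws ≤ ℓ (prod ws)
    len′ = ≤-pred (≤-trans len (ℓ-gen· s (prod ws)))
    lt : ℓ (gen s · (gen s · prod ws)) < ℓ (gen s · prod ws)
    lt = subst (λ z → ℓ z < ℓ (gen s · prod ws)) (sym (gen-gen-· s _)) (≤-trans (s≤s (ℓ-≤ ws)) len)
    par′ : InParabolic I (prod ws)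
    par′ with exchange vs (gen s) (trans (cong (λ z → η z (gen s)) eq) (left-descent⇒η lt))
    ... | us , eq′ , _ , sub = us , sub all , trans eq′ (trans (cong (gen s ·_) eq) (gen-gen-· s _))
    par-s : InParabolic I (gen s)
    par-s = subst (InParabolic I)
      (trans (assoc _ _ _) (trans (cong (gen s ·_) (invʳ (prod ws))) (idʳ (gen s)))) (par-· par (par-inv par′))

  par⇒supp⊆ : ∀ {I u} → InParabolic I u → ∀ s → Supp u s → I s
  par⇒supp⊆ par s (ws , refl , red , s∈ws) = All.lookup (par⇒letters ws (≤-reflexive (reduced⇒ℓ ws red)) par) s∈ws

  par-supp : ∀ u → InParabolic (Supp u) u
  par-supp u with reducedWord u
  ... | ws , refl , len = ws , All.tabulate (λ s∈ws → ws , refl , ℓ⇒reduced ws (≤-reflexive len) , s∈ws) , refl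

  -- When lengths add, reduced words of the factors join to a reduced word.
  supp-·ˡ : ∀ {a u s} → ℓ (a · u) ≡ ℓ a + ℓ u → Supp a s → Supp (a · u) s
  supp-·ˡ {u = u} eq (ws , refl , red , s∈ws) with reducedWord u
  ... | vs , refl , len = ws ++ vs , prod-++ ws vs ,
        ℓ⇒reduced (ws ++ vs) (≤-reflexive (trans (length-++ ws {vs})
          (trans (cong₂ _+_ (reduced⇒ℓ ws red) len) (trans (sym eq) (cong ℓ (sym (prod-++ ws vs))))))) , ∈-++⁺ˡ s∈ws

  supp-·ʳ : ∀ {a u s} → ℓ (a · u) ≡ ℓ a + ℓ u → Supp u s → Supp (a · u) s
  supp-·ʳ {a = a} eq (vs , refl , red , s∈vs) with reducedWord a
  ... | ws , refl , len = ws ++ vs , prod-++ ws vs ,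
        ℓ⇒reduced (ws ++ vs) (≤-reflexive (trans (length-++ ws {vs})
          (trans (cong₂ _+_ len (reduced⇒ℓ vs red)) (trans (sym eq) (cong ℓ (sym (prod-++ ws vs))))))) , ∈-++⁺ʳ ws s∈vs

  ℓ-gen≡1 : ∀ s → ℓ (gen s) ≡ 1
  ℓ-gen≡1 s = ≤-antisym (ℓ-gen s) (e≢⇒ℓ>0 (gen-nontriv s))

  gen-supp : ∀ s → Supp (gen s) s
  gen-supp s = s ∷ [] , idʳ (gen s) ,
    ℓ⇒reduced (s ∷ []) (≤-reflexive (sym (trans (cong ℓ (idʳ (gen s))) (ℓ-gen≡1 s)))) , here refl

  descent⇒ℓ : ∀ {a s} → ℓ (a · gen s) < ℓ a → ℓ a ≡ suc (ℓ (a · gen s))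
  descent⇒ℓ {a} {s} lt = ≤-antisym (ℓ-·gen a s) lt

  descent⇒supp : ∀ {a s} → ℓ (a · gen s) < ℓ a → Supp a s
  descent⇒supp {a} {s} lt = subst (λ z → Supp z s) (gen-cancelʳ a s) (supp-·ʳ eq (gen-supp s))
    where
    eq : ℓ ((a · gen s) · gen s) ≡ ℓ (a · gen s) + ℓ (gen s)
    eq = trans (cong ℓ (gen-cancelʳ a s)) (trans (descent⇒ℓ lt)
           (trans (+-comm 1 _) (cong (ℓ (a · gen s) +_) (sym (ℓ-gen≡1 s)))))

  par-descent : ∀ {I b} → InParabolic I b → b ≢ e → ∃ λ s → I s × ℓ (b · gen s) < ℓ b
  par-descent par b≢e with par-reduced par
  ... | ws , all , eq , len with initLast ws
  ... | [] = contradiction (sym eq) b≢e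
  ... | ws ∷ʳ′ s = s , proj₂ (All.∷ʳ⁻ all) ,
        (begin-strict
           ℓ (_ · gen s)      ≡⟨ cong (λ z → ℓ (z · gen s)) (trans (sym eq) (prod-++ ws (s ∷ []))) ⟩
           ℓ ((prod ws · (gen s · e)) · gen s)  ≡⟨ cong (λ z → ℓ ((prod ws · z) · gen s)) (idʳ (gen s)) ⟩
           ℓ ((prod ws · gen s) · gen s)  ≡⟨ cong ℓ (gen-cancelʳ (prod ws) s) ⟩
           ℓ (prod ws)        ≤⟨ ℓ-≤ ws ⟩
           length ws          <⟨ n<1+n _ ⟩
           1 + length ws      ≡⟨ +-comm 1 _ ⟩
           length ws + 1      ≡⟨ length-++ ws ⟨
           length (ws ∷ʳ s)   ≡⟨ len ⟩
           ℓ _                ∎)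
    where open ≤-Reasoning

  -- Minimal coset representatives and additivity of length.

  refl-of-invol : ∀ w s → inv (refl-of w s) ≡ refl-of w s
  refl-of-invol w s rewrite inv-· w (gen s · inv w) | inv-· (gen s) (inv w) | inv-inv w | inv-gen s = assoc w (gen s) (inv w)

  refl-of-conj : ∀ x w s → refl-of (x · w) s ≡ x · (refl-of w s · inv x)
  refl-of-conj x w s rewrite inv-· x w | assoc x w (gen s · (inv w · inv x))
    | assoc w (gen s · inv w) (inv x) | assoc (gen s) (inv w) (inv x) = refl

  -- Builds up `b` letter by letter. If a letter `s` shortens `x · b′`, its reflection `t` is an
  -- inversion already of `x`, so `t · x` is a shorter element of the same coset. That `x` is
  -- arbitrary is what `min-≤` needs for its descent.
  add-or-shrink : ∀ {I} x b → InParabolic I b →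
    ℓ (x · b) ≡ ℓ x + ℓ b ⊎ (∃₂ λ y c → InParabolic I c × x ≡ y · c × ℓ y < ℓ x)
  add-or-shrink {I} x b par = go b par (<-wellFounded (ℓ b))
    where
    go : ∀ b → InParabolic I b → Acc _<_ (ℓ b) →
      ℓ (x · b) ≡ ℓ x + ℓ b ⊎ (∃₂ λ y c → InParabolic I c × x ≡ y · c × ℓ y < ℓ x)
    go b par (acc rec) with b ≟ e
    ... | yes refl = inj₁ (trans (cong ℓ (idʳ x)) (trans (sym (+-identityʳ _)) (cong (ℓ x +_) (sym ℓ-e))))
    ... | no b≢e with par-descent par b≢e
    ... | s , Is , lt with go (b · gen s) (par-· par (par-gen Is)) (rec lt)
    ... | inj₂ shrink = inj₂ shrink
    ... | inj₁ eq with η (x · b′) (refl-of (x · b′) s) in η-eq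
      where
      b′ : W
      b′ = b · gen s
    ... | false = inj₁ (≤-antisym (ℓ-·-≤ x b) (begin
      ℓ x + ℓ b                     ≡⟨ cong (ℓ x +_) (descent⇒ℓ lt) ⟩
      ℓ x + suc (ℓ (b · gen s))     ≡⟨ +-suc (ℓ x) _ ⟩
      suc (ℓ x + ℓ (b · gen s))     ≡⟨ cong suc eq ⟨
      suc (ℓ (x · (b · gen s)))     ≤⟨ η-false⇒< η-eq ⟩
      ℓ ((x · (b · gen s)) · gen s) ≡⟨ cong ℓ (trans (assoc _ _ _) (cong (x ·_) (gen-cancelʳ b s))) ⟩
      ℓ (x · b)                     ∎))
      where open ≤-Reasoning
    ... | true = inj₂ (t · x , r , par-r , sym x-eq , η-true⇒< η-x)
      where
      b′ = b · gen s
      r = refl-of b′ s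
      t = refl-of (x · b′) s
      par-r : InParabolic I r
      par-r = par-· par′ (par-· (par-gen Is) (par-inv par′))
        where
        par′ = par-· par (par-gen Is)
      conj-t : conj x t ≡ r
      conj-t = conj-≡⁻ x t r (refl-of-conj x b′ s)
      η-r : η b′ r ≡ false
      η-r = ascent⇒η (subst (λ z → ℓ b′ < ℓ z) (sym (gen-cancelʳ b s)) lt)
      -- The value at `t` splits into those of `x` at `t` and of `b′` at `r`; the latter is `false`
      -- because `s` is an ascent of `b′`.
      η-x : η x t ≡ true
      η-x with η-· x b′ t
      ... | eq′ rewrite conj-t | η-r | xor-identityʳ (η x t) = trans (sym eq′) η-eq
      x-eq : (t · x) · r ≡ x
      x-eq = trans (assoc t x r) (trans (cong (t ·_) (trans (cong (x ·_) (sym conj-t))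
               (·-inv-· x (t · x)))) t-t)
        where
        t-t : t · (t · x) ≡ x
        t-t = trans (cong (_· (t · x)) (sym (refl-of-invol (x · b′) s))) (inv-·-· t x)

  -- Shrink `x` inside its coset while possible. Once lengths add, a nontrivial `c` would hand its
  -- right descent in `I` on to `a`.
  min-≤ : ∀ {I a c} x → InMinCoset I a → InParabolic I c → a ≡ x · c → ℓ a ≤ ℓ x
  min-≤ {I} {a} x min par eq = go x par eq (<-wellFounded (ℓ x))
    where
    go : ∀ x {c} → InParabolic I c → a ≡ x · c → Acc _<_ (ℓ x) → ℓ a ≤ ℓ x
    go x {c} par eq (acc rec) with add-or-shrink x c par
    ... | inj₂ (y , d , par′ , refl , lt) =
          ≤-trans (go y (par-· par′ par) (trans eq (assoc _ _ _)) (rec lt)) (<⇒≤ lt)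
    ... | inj₁ add with c ≟ e
    ... | yes refl = ≤-reflexive (cong ℓ (trans eq (idʳ x)))
    ... | no c≢e with par-descent par c≢e
    ... | s , Is , lt = contradiction (<⇒descent descent) (min s Is)
      where
      open ≤-Reasoning
      descent : ℓ (a · gen s) < ℓ a
      descent = begin-strict
        ℓ (a · gen s)        ≡⟨ cong ℓ (trans (cong (_· gen s) eq) (assoc _ _ _)) ⟩
        ℓ (x · (c · gen s))  ≤⟨ ℓ-·-≤ x (c · gen s) ⟩
        ℓ x + ℓ (c · gen s)  <⟨ +-monoʳ-< (ℓ x) lt ⟩
        ℓ x + ℓ c            ≡⟨ add ⟨
        ℓ (x · c)            ≡⟨ cong ℓ eq ⟨
        ℓ a                  ∎

  -- The other alternative would make `a` a shorter element times one of W_I, which `min-≤`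
  -- excludes.
  ℓ-add : ∀ {I a b} → InMinCoset I a → InParabolic I b → ℓ (a · b) ≡ ℓ a + ℓ b
  ℓ-add {a = a} {b} min par with add-or-shrink a b par
  ... | inj₁ eq = eq
  ... | inj₂ (y , c , par′ , eq , lt) = contradiction lt (≤⇒≯ (min-≤ y min par′ eq))

  factor : ∀ {I} → Decidable I → ∀ w → ∃₂ λ a b → InMinCoset I a × InParabolic I b × w ≡ a · b
  factor {I} I? w = go w (<-wellFounded (ℓ w))
    where
    go : ∀ w → Acc _<_ (ℓ w) → ∃₂ λ a b → InMinCoset I a × InParabolic I b × w ≡ a · b
    go w (acc rec) with Fin.any? (λ s → I? s ×-dec (ℓ (w · gen s) <? ℓ w))
    ... | no none = w , e , (λ s Is desc → none (s , Is , descent⇒< desc)) , par-e , sym (idʳ w)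
    ... | yes (s , Is , lt) with go (w · gen s) (rec lt)
    ... | a , b , min , par , eq = a , b · gen s , min , par-· par (par-gen Is) ,
          trans (sym (gen-cancelʳ w s)) (trans (cong (_· gen s) eq) (assoc _ _ _))

  min-mono : ∀ {I J : Pred (Fin n) 0ℓ} {x} → (∀ s → I s → J s) → InMinCoset J x → InMinCoset I x
  min-mono sub min s Is = min s (sub s Is)

  -- Length is additive on `x` times W_J, so `x · b` and `b` have the same right descents in `K`.
  min-· : ∀ {J K x b} → (∀ s → K s → J s) → InMinCoset J x → InParabolic J b → InMinCoset K b → InMinCoset K (x · b)
  min-· {x = x} {b} sub min-x par min-b s Ks desc = min-b s Ks (<⇒descent (+-cancelˡ-< (ℓ x) _ _
    (subst₂ _<_ (trans (cong ℓ (assoc _ _ _)) (ℓ-add min-x (par-· par (par-gen (sub s Ks))))) (ℓ-add min-x par) (descent⇒< desc))))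

  min-·⁻ : ∀ {J K x b} → (∀ s → K s → J s) → InMinCoset J x → InParabolic J b → InMinCoset K (x · b) → InMinCoset K b
  min-·⁻ {x = x} {b} sub min-x par min-xb s Ks desc = min-xb s Ks (<⇒descent
    (subst₂ _<_ (sym (trans (cong ℓ (assoc _ _ _)) (ℓ-add min-x (par-· par (par-gen (sub s Ks)))))) (sym (ℓ-add min-x par))
      (+-monoʳ-< (ℓ x) (descent⇒< desc))))

  -- Lengths add in `b · inv b`, which is `e`.
  min∧par⇒e : ∀ {I b} → InMinCoset I b → InParabolic I b → b ≡ e
  min∧par⇒e {b = b} min par = ℓ≡0⇒e (m+n≡0⇒m≡0 (ℓ b)
    (trans (sym (ℓ-add min (par-inv par))) (trans (cong ℓ (invʳ b)) ℓ-e)))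

  -- First properties of the BHZ order.

  supp-e : ∀ s → ¬ Supp e s
  supp-e s (ws , eq , red , s∈ws) with ws | red [] (sym eq)
  supp-e s (_ , eq , red , ()) | [] | _

  e-≤β : ∀ w → e ≤β w
  e-≤β w = w , (λ s Ss → contradiction Ss (supp-e s)) , par-supp e , idʳ w

  -- Lengths add in the factorization `a · u` of `v`, so the supports of `a` and `u` lie in that of
  -- `v`, and `min-·` applies to `b · a`.
  ≤β-trans : ∀ {u v w} → u ≤β v → v ≤β w → u ≤β w
  ≤β-trans {u} (a , min-a , par-u , refl) (b , min-b , _ , refl) =
    b · a ,
    min-· (λ s → supp-·ʳ add) min-b (par-mono (λ s → supp-·ˡ add) (par-supp a)) min-a ,
    par-u , assoc b a u
    where
    add = ℓ-add min-a par-u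

  -- Faces of the permutahedron, and simplices built from chains.

  coset-trans : ∀ {I x y z} → InCoset x I y → InCoset y I z → InCoset x I z
  coset-trans {x = x} {y} {z} p q =
    subst (InParabolic _) (trans (assoc _ _ _) (cong (inv x ·_) (·-inv-· y z))) (par-· p q)

  coset-sym : ∀ {I x y} → InCoset x I y → InCoset y I x
  coset-sym {x = x} {y} p =
    subst (InParabolic _) (trans (inv-· (inv x) y) (cong (inv y ·_) (inv-inv x))) (par-inv p)

  coset-refl : ∀ {I} x → InCoset x I x
  coset-refl x = subst (InParabolic _) (sym (invˡ x)) par-e

  minVertex⇒min : ∀ {x I v} → MinVertex x I v → InMinCoset I v
  minVertex⇒min {v = v} (v∈ , below) s Is desc
    with below (v · gen s) (coset-trans v∈ (subst (InParabolic _) (sym (inv-·-· v (gen s))) (par-gen Is)))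
  ... | a , b , c , _ , len-b , len-c , eq = contradiction (descent⇒< desc)
        (≤⇒≯ (subst₂ _≤_ (isLength-≡ len-c) (isLength-≡ len-b) (subst (c ≤_) eq (m≤n+m c a))))

  min⇒minVertex : ∀ {x I} → InMinCoset I x → MinVertex x I x
  min⇒minVertex {x} min = coset-refl x , λ y y∈ →
    ℓ (inv x · y) , ℓ y , ℓ x , ℓ-isLength _ , ℓ-isLength _ , ℓ-isLength _ ,
    trans (+-comm _ (ℓ x)) (trans (sym (ℓ-add min y∈)) (cong ℓ (·-inv-· x y)))

  -- The facet through `x · b` avoids `x`: otherwise `b` would lie in the parabolic subgroup of
  -- `J minus s`, for which it is also minimal, and be `e`.
  cone-over : ∀ {x J b s σ} → InMinCoset J x → InParabolic J b → InMinCoset (J minus s) b → J s → b ≢ e →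
    PullSimplex (x · b) (J minus s) σ → PullSimplex x J (x ∷ σ)
  cone-over {x} {J} {b} {s} min-x par min-b Js b≢e = cone (min⇒minVertex min-x) Js
    (subst (InParabolic _) (sym (inv-·-· x b)) par)
    (λ x∈ → b≢e (min∧par⇒e min-b (subst (InParabolic _) (inv-·-· x b) (coset-sym x∈))))

  -- A finite list for `J` makes it decidable, and bounds on its length drive the induction over
  -- faces.
  Enumerates : Word → Pred (Fin n) 0ℓ → Set
  Enumerates L J = ∀ s → (J s → s ∈ L) × (s ∈ L → J s)

  remove : Fin n → Word → Word
  remove s = filter (λ t → ¬? (t Fin.≟ s))

  enumerates-minus : ∀ {L J s} → Enumerates L J → Enumerates (remove s L) (J minus s)
  enumerates-minus {s = s} enum t =
    (λ { (Jt , t≢s) → ∈-filter⁺ (λ t → ¬? (t Fin.≟ s)) (proj₁ (enum t) Jt) t≢s }) ,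
    (λ t∈ → let t∈L , t≢s = ∈-filter⁻ (λ t → ¬? (t Fin.≟ s)) t∈ in proj₂ (enum t) t∈L , t≢s)

  length-remove : ∀ s L {k} → s ∈ L → length L ≤ suc k → length (remove s L) ≤ k
  length-remove s L s∈L len = ≤-pred (≤-trans
    (filter-notAll (λ t → ¬? (t Fin.≟ s)) L (Any.map (λ { refl t≢s → t≢s refl }) s∈L)) len)

  enumerates⇒dec : ∀ {L J} → Enumerates L J → Decidable J
  enumerates⇒dec {L} enum s = map′ (proj₂ (enum s)) (proj₁ (enum s)) (s ∈? L)
    where open DecMembership Fin._≟_ using (_∈?_)

  min-e : ∀ {I} → InMinCoset I e
  min-e s _ desc = contradiction (subst (ℓ (e · gen s) <_) ℓ-e (descent⇒< desc)) λ ()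

  -- If `t` shortened `gen s`, then `gen s · gen t` would be `e`. This supplies a facet avoiding the
  -- apex when the chain has run out.
  gen-min : ∀ {J} s → InMinCoset (J minus s) (gen s)
  gen-min s t (_ , t≢s) desc = t≢s (sym (gen-inj s t (trans (inverseˡ-unique _ _ st≡e) (inv-gen t))))
    where
    st≡e : gen s · gen t ≡ e
    st≡e = ℓ≡0⇒e (n<1⇒n≡0 (≤-trans (descent⇒< desc) (ℓ-gen s)))

  -- With s a right descent of a, the facet of W_J of type J ∖ s through a
  -- avoids e and still contains a W_{S(u)}; b is its minimal vertex.
  avoiding-facet : ∀ {J a u} → Decidable J → InMinCoset (Supp u) a → InParabolic J a → InParabolic J u → a ≢ e →
    ∃ λ s → J s × ∃₂ λ b c → b ≢ e × InParabolic J b × InMinCoset (J minus s) b ×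
      InParabolic (J minus s) (c · u) × InMinCoset (Supp u) c × a ≡ b · c
  avoiding-facet {J} {a} {u} J? min-a par-a par-u a≢e with par-descent par-a a≢e
  ... | s , Js , lt with factor {J minus s} (λ t → J? t ×-dec ¬? (t Fin.≟ s)) a
  ... | b , c , min-b , par-c , refl = s , Js , b , c , b≢e ,
        subst (InParabolic J) bc-c (par-· par-a (par-inv (par-mono (λ _ → proj₁) par-c))) , min-b ,
        par-· par-c (par-mono supp⊆ (par-supp u)) , min-·⁻ supp⊆ min-b par-c min-a , refl
    where
    supp⊆ : ∀ t → Supp u t → (J minus s) t
    -- `s` is a right descent of `a`, while `a` has none in the support of `u`.
    supp⊆ t St = par⇒supp⊆ par-u t St , λ { refl → min-a t St (<⇒descent lt) }
    b≢e : b ≢ e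
    -- If `b` were `e`, then `a` would be `c`, whose support omits `s`; but a right descent lies in
    -- the support.
    b≢e refl = proj₂ (par⇒supp⊆ (subst (InParabolic (J minus s)) (sym (idˡ c)) par-c) s (descent⇒supp lt)) refl
    bc-c : (b · c) · inv c ≡ b
    bc-c = trans (assoc b c (inv c)) (trans (cong (b ·_) (invʳ c)) (idʳ b))

  -- The chain is listed from its top `u` downwards, and `u` itself gives the apex `x`. The vertices
  -- of the elements below `u` all lie in one facet avoiding `x`, to which induction applies.
  chain⇒simplex : ∀ k L J → length L ≤ k → Enumerates L J → ∀ x u us → InMinCoset J x → InParabolic J u →
    Linked (flip _<β_) (u ∷ us) → ∃ λ σ → PullSimplex x J σ × (∀ v → v ∈ u ∷ us → x · (u · inv v) ∈ σ)
  chain⇒simplex k [] J _ enum x u [] min par _ = x ∷ [] , point (λ s Js → contradiction (proj₁ (enum s) Js) λ ()) ,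
    λ { _ (here refl) → here (trans (cong (x ·_) (invʳ u)) (idʳ x)) }
  -- Only the apex is asked for, but the simplex must be maximal: it continues in the facet at
  -- `x · gen s`, with `e` as a one-element chain.
  chain⇒simplex (suc k) L@(s ∷ _) J len enum x u [] min par _
    with chain⇒simplex k (remove s L) (J minus s) (length-remove s L (here refl) len) (enumerates-minus enum)
           (x · gen s) e [] (min-· (λ _ → proj₁) min (par-gen (proj₂ (enum s) (here refl))) (gen-min s)) par-e [-]
  ... | σ , simplex , _ = x ∷ σ , cone-over min (par-gen Js) (gen-min s) Js (gen-nontriv s) simplex ,
    λ { _ (here refl) → here (trans (cong (x ·_) (invʳ u)) (idʳ x)) }
    where
    Js : J s
    Js = proj₂ (enum s) (here refl)
  chain⇒simplex k L J len enum x u (u′ ∷ us) min par (((a , min-a , par-u′ , refl) , u′≢u) ∷ linked)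
    with avoiding-facet (enumerates⇒dec enum) min-a
           (par-mono (λ s → par⇒supp⊆ par s ∘ supp-·ˡ (ℓ-add min-a par-u′)) (par-supp a))
           (par-mono (λ s → par⇒supp⊆ par s ∘ supp-·ʳ (ℓ-add min-a par-u′)) (par-supp u′))
           (λ { refl → u′≢u (sym (idˡ u′)) })
  ... | s , Js , b , c , b≢e , par-b , min-b , par-cu′ , min-c , refl
    with proj₁ (enum s) Js | k
  ... | s∈L | zero = contradiction len (<⇒≱ (∈-length s∈L))
  ... | s∈L | suc k = extend facet
    where
    Facet : Set₁
    Facet = ∃ λ σ → PullSimplex (x · b) (J minus s) σ × (∀ v → v ∈ u′ ∷ us → (x · b) · ((c · u′) · inv v) ∈ σ)
    facet : Facet
    facet with c ≟ e
    -- Here `x · b` is the vertex belonging to `u′`, so `u′` becomes the new top.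
    ... | yes refl with chain⇒simplex k (remove s L) (J minus s) (length-remove s L s∈L len) (enumerates-minus enum)
                          (x · b) u′ us (min-· (λ _ → proj₁) min par-b min-b)
                          (subst (InParabolic (J minus s)) (idˡ u′) par-cu′) linked
    ... | σ , simplex , ⊆σ = σ , simplex ,
          λ v v∈ → subst (λ z → (x · b) · (z · inv v) ∈ σ) (sym (idˡ u′)) (⊆σ v v∈)
    -- Here `x · b` is not the vertex of `u′`. The element `c · u′`, strictly above `u′`, is put on
    -- top as a stand-in, and its own vertex is dropped from the conclusion.
    facet | no c≢e with chain⇒simplex k (remove s L) (J minus s) (length-remove s L s∈L len) (enumerates-minus enum)
                          (x · b) (c · u′) (u′ ∷ us) (min-· (λ _ → proj₁) min par-b min-b) par-cu′
                          (((c , min-c , par-u′ , refl) , λ eq → c≢e (identityˡ-unique c u′ (sym eq))) ∷ linked)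
    ... | σ , simplex , ⊆σ = σ , simplex , λ v v∈ → ⊆σ v (there v∈)
    extend : Facet → ∃ λ σ → PullSimplex x J σ × (∀ v → v ∈ ((b · c) · u′) ∷ u′ ∷ us → x · (((b · c) · u′) · inv v) ∈ σ)
    extend (σ , simplex , ⊆σ) = x ∷ σ , cone-over min par-b min-b Js b≢e simplex , λ where
      _ (here refl) → here (trans (cong (x ·_) (invʳ _)) (idʳ x))
      v (there v∈) → there (subst (_∈ σ)
        (trans (assoc _ _ _) (cong (x ·_) (trans (sym (assoc _ _ _)) (cong (_· inv v) (sym (assoc _ _ _))))))
        (⊆σ v v∈))

  reverse-lastOf : ∀ u us → ∃ λ vs → reverse (u ∷ us) ≡ lastOf u us ∷ vs
  reverse-lastOf u us = go u [] us
    where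
    go : ∀ x (rev xs : List W) → ∃ λ vs → foldl (flip _∷_) (x ∷ rev) xs ≡ lastOf x xs ∷ vs
    go x rev [] = rev , refl
    go x rev (y ∷ xs) = go y (x ∷ rev) xs

  φe-simplex : ∀ {u us} → Linked _<β_ (u ∷ us) → ∃ λ σ → PullSimplex e fullS σ × φe (u ∷ us) ⊆ σ
  φe-simplex {u} {us} linked with reverse-lastOf u us
  ... | vs , rev with chain⇒simplex _ (allFin n) fullS ≤-refl (λ s → (λ _ → ∈-allFin s) , (λ _ → tt)) e
                        (lastOf u us) vs min-e
                        (par-mono (λ _ _ → tt) (par-supp _)) (subst (Linked _) rev (Linked-reverse linked))
  ... | σ , simplex , ⊆σ = σ , simplex , sub
    where
    sub : φe (u ∷ us) ⊆ σ
    sub w w∈ with ∈-map⁻ (λ x → lastOf u us · inv x) w∈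
    ... | v , v∈ , refl = subst (_∈ σ) (idˡ _) (⊆σ v (subst (v ∈_) rev (Any.reverse⁺ v∈)))

  -- Lengths of the vertices, and injectivity of `φ`.

  ≤β-refl : ∀ u → u ≤β u
  ≤β-refl u = e , min-e , par-supp u , idˡ u

  ≤β-lastOf : ∀ {u us} → Linked _<β_ (u ∷ us) → u ≤β lastOf u us
  ≤β-lastOf {u} [-] = ≤β-refl u
  ≤β-lastOf (u<v ∷ linked) = ≤β-trans (proj₁ u<v) (≤β-lastOf linked)

  -- The two quotients are `b` and `b · a`; lengths add in the product, and `a` is not `e`.
  quotient-< : ∀ {u v t} → u <β v → v ≤β t → ℓ (t · inv v) < ℓ (t · inv u)
  quotient-< {u} ((a , min-a , par-u , refl) , u≢v) (b , min-b , _ , refl) =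
    subst₂ _<_ (cong ℓ (sym (//-cancel b (a · u))))
      (trans (sym (ℓ-add min-b (par-mono (λ s → supp-·ˡ (ℓ-add min-a par-u)) (par-supp a))))
             (cong ℓ (sym (trans (cong (_· inv u) (sym (assoc b a u))) (//-cancel (b · a) u)))))
      (m<m+n (ℓ b) (e≢⇒ℓ>0 λ { refl → u≢v (sym (idˡ u)) }))
    where
    //-cancel : ∀ x y → (x · y) · inv y ≡ x
    //-cancel x y = trans (assoc _ _ _) (trans (cong (x ·_) (invʳ y)) (idʳ x))

  φe-sorted : ∀ {u us} → Linked _<β_ (u ∷ us) → AllPairs (λ v w → ℓ w < ℓ v) (φe (u ∷ us))
  φe-sorted linked = Linked.Linked⇒AllPairs (flip <-trans) (Linked.map⁺ (go linked))
    where
    go : ∀ {u us} → Linked _<β_ (u ∷ us) →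
      Linked (λ v w → ℓ (lastOf u us · inv w) < ℓ (lastOf u us · inv v)) (u ∷ us)
    go [-] = [-]
    go (u<v ∷ linked) = quotient-< u<v (≤β-lastOf linked) ∷ go linked

  φe-∷ʳ : ∀ u us → ∃ λ ws → φe (u ∷ us) ≡ ws ∷ʳ e × length ws ≡ length us
  φe-∷ʳ u us = go (lastOf u us) u us refl
    where
    go : ∀ t u us → lastOf u us ≡ t → ∃ λ ws → map (λ x → t · inv x) (u ∷ us) ≡ ws ∷ʳ e × length ws ≡ length us
    go t u [] refl = [] , cong (_∷ []) (invʳ u) , refl
    go t u (v ∷ us) eq with go t v us eq
    ... | ws , eq′ , len = (t · inv u) ∷ ws , cong ((t · inv u) ∷_) eq′ , cong suc len

  φ-e∷ : ∀ us → φ (e ∷ us) ≡ φe (e ∷ us)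
  φ-e∷ us with e ≟ e
  ... | yes _ = refl
  ... | no e≢e = contradiction refl e≢e

  φ-filter : ∀ {u} us → u ≢ e → φ (u ∷ us) ≡ filter (λ x → ¬? (x ≟ e)) (φe (e ∷ u ∷ us))
  φ-filter {u} us u≢e with u ≟ e
  ... | yes u≡e = contradiction u≡e u≢e
  ... | no _ = refl

  -- Lengths strictly decrease along the list, so `e` occurs only at its end and the filter removes
  -- just that entry. Chains without `e` are thereby reduced to `φe`.
  φ-∷ʳe : ∀ {u us} → u ≢ e → Linked _<β_ (e ∷ u ∷ us) →
    φe (e ∷ u ∷ us) ≡ φ (u ∷ us) ∷ʳ e × length (φ (u ∷ us)) ≡ suc (length us)
  φ-∷ʳe {u} {us} u≢e linked with φe-∷ʳ e (u ∷ us)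
  ... | ws , eq , len = trans eq (cong (_∷ʳ e) (sym φ≡ws)) , trans (cong length φ≡ws) len
    where
    P? : ∀ x → Dec (x ≢ e)
    P? x = ¬? (x ≟ e)
    ws≢e : All (_≢ e) ws
    ws≢e = All.map (λ { lt refl → <-irrefl refl lt })
      (AllPairs-∷ʳ⁻ ws (subst (AllPairs (λ v w → ℓ w < ℓ v)) eq (φe-sorted linked)))
    filter-e : filter P? (e ∷ []) ≡ []
    filter-e = filter-reject P? (λ e≢e → e≢e refl)
    φ≡ws : φ (u ∷ us) ≡ ws
    φ≡ws = trans (φ-filter us u≢e) (trans (cong (filter P?) eq) (trans (filter-++ P? ws (e ∷ []))
             (trans (cong₂ _++_ (filter-all P? ws≢e) filter-e) (++-identityʳ ws))))

  chain-with-e : ∀ {u us} → u ≢ e → Linked _<β_ (u ∷ us) → Linked _<β_ (e ∷ u ∷ us)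
  chain-with-e {u} u≢e linked = (e-≤β u , u≢e ∘ sym) ∷ linked

  φ-sorted : ∀ {u us} → Linked _<β_ (u ∷ us) → AllPairs (λ v w → ℓ w < ℓ v) (φ (u ∷ us))
  φ-sorted {u} {us} linked = case (u ≟ e)
    where
    case : Dec (u ≡ e) → AllPairs (λ v w → ℓ w < ℓ v) (φ (u ∷ us))
    case (yes refl) = subst (AllPairs _) (sym (φ-e∷ us)) (φe-sorted linked)
    case (no u≢e) = subst (AllPairs _) (sym (φ-filter us u≢e)) (AllPairs.filter⁺ (λ x → ¬? (x ≟ e)) (φe-sorted (chain-with-e u≢e linked)))

  φ-length : ∀ {u us} → Linked _<β_ (u ∷ us) → length (φ (u ∷ us)) ≡ length (u ∷ us)
  φ-length {u} {us} linked = case (u ≟ e)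
    where
    case : Dec (u ≡ e) → length (φ (u ∷ us)) ≡ length (u ∷ us)
    case (yes refl) = trans (cong length (φ-e∷ us)) (length-map _ (e ∷ us))
    case (no u≢e) = proj₂ (φ-∷ʳe u≢e (chain-with-e u≢e linked))

  φ-unique : ∀ {u us} → Linked _<β_ (u ∷ us) → Unique (φ (u ∷ us))
  φ-unique linked = AllPairs.map (λ { lt refl → <-irrefl refl lt }) (φ-sorted linked)

  φ-face : ∀ {u us} → Linked _<β_ (u ∷ us) → IsFaceΔ (φ (u ∷ us))
  φ-face {u} {us} linked = nonempty , φ-unique linked , case (u ≟ e)
    where
    nonempty : φ (u ∷ us) ≢ []
    nonempty eq with trans (sym (φ-length linked)) (cong length eq)
    ... | ()
    case : Dec (u ≡ e) → ∃ λ σ → PullSimplex e fullS σ × φ (u ∷ us) ⊆ σ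
    case (yes refl) with φe-simplex linked
    ... | σ , simplex , sub = σ , simplex , λ x x∈ → sub x (subst (x ∈_) (φ-e∷ us) x∈)
    case (no u≢e) with φe-simplex (chain-with-e u≢e linked)
    ... | σ , simplex , sub = σ , simplex ,
          λ x x∈ → sub x (proj₁ (∈-filter⁻ (λ x → ¬? (x ≟ e)) (subst (x ∈_) (φ-filter us u≢e) x∈)))

  -- The first entry is the top of the chain; once it is known, every other element can be
  -- recovered.
  φe-injective : ∀ {us vs} → φe (e ∷ us) ≡ φe (e ∷ vs) → us ≡ vs
  φe-injective {us} {vs} eq = proj₂ (∷-injective (map-injective inj
      (trans eq (cong (λ t → map (λ x → t · inv x) (e ∷ vs)) (sym last≡)))))
    where
    last≡ : lastOf e us ≡ lastOf e vs
    last≡ = ∙-cancelʳ (inv e) _ _ (proj₁ (∷-injective eq))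
    inj : ∀ {x y} → lastOf e us · inv x ≡ lastOf e us · inv y → x ≡ y
    inj p = inv-injective (∙-cancelˡ (lastOf e us) _ _ p)

  e∈φ-e∷ : ∀ us → e ∈ φ (e ∷ us)
  e∈φ-e∷ us with φe-∷ʳ e us
  ... | ws , eq , _ = subst (e ∈_) (sym (trans (φ-e∷ us) eq)) (∈-++⁺ʳ ws (here refl))

  e∉φ : ∀ {u us} → u ≢ e → ¬ e ∈ φ (u ∷ us)
  e∉φ {u} {us} u≢e e∈ = proj₂ (∈-filter⁻ (λ x → ¬? (x ≟ e)) (subst (e ∈_) (φ-filter us u≢e) e∈)) refl

  -- Both lists are sorted by length, so they agree as lists; membership of `e` tells whether the
  -- chain starts with `e`.
  φ-injective : ∀ {u us v vs} → Linked _<β_ (u ∷ us) → Linked _<β_ (v ∷ vs) →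
    SameSet (φ (u ∷ us)) (φ (v ∷ vs)) → u ∷ us ≡ v ∷ vs
  φ-injective {u} {us} {v} {vs} lu lv (sub , sup) = case (u ≟ e) (v ≟ e)
    where
    φ≡ : φ (u ∷ us) ≡ φ (v ∷ vs)
    φ≡ = sorted-unique <-asym (φ-sorted lu) (φ-sorted lv) sub sup
    case : Dec (u ≡ e) → Dec (v ≡ e) → u ∷ us ≡ v ∷ vs
    case (yes refl) (yes refl) = cong (e ∷_) (φe-injective (trans (sym (φ-e∷ us)) (trans φ≡ (φ-e∷ vs))))
    case (yes refl) (no v≢e) = contradiction (sub e (e∈φ-e∷ us)) (e∉φ v≢e)
    case (no u≢e) (yes refl) = contradiction (sup e (e∈φ-e∷ vs)) (e∉φ u≢e)
    case (no u≢e) (no v≢e) = φe-injective (trans (proj₁ (φ-∷ʳe u≢e (chain-with-e u≢e lu)))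
      (trans (cong (_∷ʳ e) φ≡) (sym (proj₁ (φ-∷ʳe v≢e (chain-with-e v≢e lv))))))

  -- From simplices back to chains.

  -- Keeps of a pulling simplex only what passes to sublists: the next `J` may lose several
  -- generators at once, so faces that are not maximal are covered too.
  data Flag : Pred (Fin n) 0ℓ → List W → Set₁ where
    nil : ∀ {I} → Flag I []
    cons : ∀ {I J v τ} → (∀ s → J s → I s) → InMinCoset J v →
      All (λ w → InCoset v J w × w ≢ v) τ → Flag J τ → Flag I (v ∷ τ)

  flag-mono : ∀ {I J τ} → (∀ s → I s → J s) → Flag I τ → Flag J τ
  flag-mono sub nil = nil
  flag-mono sub (cons sub′ min all flag) = cons (λ s → sub s ∘ sub′ s) min all flag

  flag-filter : ∀ {I τ} {P : Pred W 0ℓ} (P? : Decidable P) → Flag I τ → Flag I (filter P? τ)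
  flag-filter P? nil = nil
  flag-filter {τ = v ∷ τ} P? (cons sub min all flag) with P? v
  ... | yes _ = cons sub min (All.filter⁺ P? all) (flag-filter P? flag)
  ... | no _ = flag-mono sub (flag-filter P? flag)

  -- Later vertices lie in a facet of the face, hence in the coset of the apex `v`; they differ from
  -- `v` because the facet misses it.
  simplex⇒flag : ∀ {x I σ} → PullSimplex x I σ → Flag I σ × All (InCoset x I) σ
  simplex⇒flag {x} (point none) = cons (λ _ Is → Is) (λ s Is → contradiction Is (none s)) [] nil , coset-refl x ∷ []
  simplex⇒flag {x} {I} (cone {v = v} {y} {s} minV Is y∈ v∉ simplex) with simplex⇒flag simplex
  ... | flag , all =
        cons (λ _ Is → Is) (minVertex⇒min minV)
          (All.map (λ w∈ → coset-trans (coset-sym (proj₁ minV)) (x∼ w∈) , λ { refl → v∉ w∈ }) all)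
          (flag-mono (λ _ → proj₁) flag) ,
        proj₁ minV ∷ All.map x∼ all
    where
    x∼ : ∀ {w} → InCoset y (I minus s) w → InCoset x I w
    x∼ w∈ = coset-trans y∈ (par-mono (λ _ → proj₁) w∈)

  ≤R-e : ∀ {v} → v ≤R e → v ≡ e
  ≤R-e {v} (a , b , c , _ , len-b , len-c , eq) = ℓ≡0⇒e
    (trans (sym (isLength-≡ len-c)) (m+n≡0⇒n≡0 a (trans eq (trans (isLength-≡ len-b) ℓ-e))))

  simplex-head : ∀ {σ} → PullSimplex e fullS σ → ∃ λ τ → σ ≡ e ∷ τ
  simplex-head (point _) = [] , refl
  simplex-head (cone {σ = τ} minV _ _ _ _) = τ , cong (_∷ τ) (≤R-e (proj₂ minV e (coset-refl e)))

  lastOf∈ : ∀ x xs → lastOf x xs ∈ x ∷ xs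
  lastOf∈ x [] = here refl
  lastOf∈ x (y ∷ xs) = there (lastOf∈ y xs)

  lastOf-map : ∀ (f : W → W) x xs → lastOf (f x) (map f xs) ≡ f (lastOf x xs)
  lastOf-map f x [] = refl
  lastOf-map f x (y ∷ xs) = lastOf-map f y xs

  lastOf-reverse : ∀ x xs {y ys} → reverse (x ∷ xs) ≡ y ∷ ys → lastOf y ys ≡ x
  lastOf-reverse x xs {y} {ys} eq with reverse-lastOf y ys
  ... | zs , eq′ = proj₁ (∷-injective (trans (sym eq′) (trans (cong reverse (sym eq)) (reverse-involutive (x ∷ xs)))))

  -- With z the last vertex, `inv v · z` is `inv v · w` times `inv w · z`. The support of the second
  -- factor lies in `K`; the first has no descent in `K`, since `w` has none and `v` is minimal for
  -- the larger `J`.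
  flag⇒linked : ∀ {I v τ} → Flag I (v ∷ τ) → Linked (λ x y → (inv y · lastOf v τ) <β (inv x · lastOf v τ)) (v ∷ τ)
  flag⇒linked {τ = []} _ = [-]
  flag⇒linked {v = v} {w ∷ τ} (cons {J = J} _ min-v ((w∈ , w≢v) ∷ _) flag@(cons {J = K} sub min-w all _)) =
    ((inv v · w , min-mono (par⇒supp⊆ par-z) min-a , par-supp _ , a-eq) , distinct) ∷ flag⇒linked flag
    where
    z : W
    z = lastOf w τ
    par-z : InParabolic K (inv w · z)
    par-z with lastOf∈ w τ
    ... | here eq = subst (InCoset w K) (sym eq) (coset-refl w)
    ... | there z∈τ = proj₁ (All.lookup all z∈τ)
    min-a : InMinCoset K (inv v · w)
    min-a = min-·⁻ sub min-v w∈ (subst (InMinCoset K) (sym (·-inv-· v w)) min-w)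
    a-eq : (inv v · w) · (inv w · z) ≡ inv v · z
    a-eq = trans (assoc _ _ _) (cong (inv v ·_) (·-inv-· w z))
    distinct : inv w · z ≢ inv v · z
    distinct eq = w≢v (inv-injective (∙-cancelʳ z _ _ eq))

  -- The flag is read backwards: `g` sends its last vertex `z` to `e`, and `e` to `z`, the top of
  -- the chain. Multiplying `z` by the inverse of `g v` gives back `v`.
  flag⇒chain : ∀ {I τ} → Flag I (e ∷ τ) → ∃ λ us →
    Linked _<β_ (e ∷ us) × SameSet (φe (e ∷ us)) (e ∷ τ)
  flag⇒chain {τ = τ} flag with reverse-lastOf (inv e · lastOf e τ) (map (λ v → inv v · lastOf e τ) τ)
  ... | us , rev = us , linked , sub , sup
    where
    z : W
    z = lastOf e τ
    g : W → W
    g v = inv v · z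
    rev-e : reverse (map g (e ∷ τ)) ≡ e ∷ us
    rev-e = trans rev (cong (_∷ us) (trans (lastOf-map g e τ) (invˡ z)))
    linked : Linked _<β_ (e ∷ us)
    linked = subst (Linked _<β_) rev-e (Linked-reverse (Linked.map⁺ (flag⇒linked flag)))
    last≡z : lastOf e us ≡ z
    last≡z = trans (lastOf-reverse (g e) (map g τ) rev-e) (trans (cong (_· z) inv-e) (idˡ z))
    z-g : ∀ v → lastOf e us · inv (g v) ≡ v
    z-g v = trans (cong₂ _·_ last≡z (inv-· (inv v) z)) (trans (·-inv-· z (inv (inv v))) (inv-inv v))
    sub : φe (e ∷ us) ⊆ (e ∷ τ)
    sub x x∈ with ∈-map⁻ (λ u → lastOf e us · inv u) x∈
    ... | u , u∈ , refl with ∈-map⁻ g (Any.reverse⁻ (subst (u ∈_) (sym rev-e) u∈))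
    ... | v , v∈ , refl = subst (_∈ e ∷ τ) (sym (z-g v)) v∈
    sup : (e ∷ τ) ⊆ φe (e ∷ us)
    sup v v∈ = subst (_∈ φe (e ∷ us)) (z-g v)
      (∈-map⁺ (λ u → lastOf e us · inv u) (subst (g v ∈_) rev-e (Any.reverse⁺ (∈-map⁺ g v∈))))

  φ-preimage-length : ∀ {u us F} → Linked _<β_ (u ∷ us) → Unique F → SameSet (φ (u ∷ us)) F → length (u ∷ us) ≡ length F
  φ-preimage-length linked uniq (sub , sup) =
    trans (sym (φ-length linked)) (unique-length (φ-unique linked) uniq sub sup)

  φ-surjective : ∀ F → IsFaceΔ F → ∃ λ c → IsChain c × SameSet (φ c) F × length c ≡ length F
  φ-surjective F (nonempty , uniq , σ , simplex , F⊆σ) with simplex-head simplex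
  ... | τ , refl with simplex⇒flag simplex
  -- Only the tail is cut down to `F`; `e` stays in front even if `F` omits it.
  ... | cons sub min all flag , _ with flag⇒chain (cons sub min (All.filter⁺ (_∈? F) all) (flag-filter (_∈? F) flag))
    where open DecMembership _≟_ using (_∈?_)
  ... | us , linked , ⊆τ , τ⊆ = case (e ∈? F)
    where
    open DecMembership _≟_ using (_∈?_)
    F-τ : ∀ {x} → x ∈ F → x ∈ e ∷ filter (_∈? F) τ
    F-τ {x} x∈F with F⊆σ x x∈F
    ... | here refl = here refl
    ... | there x∈τ = there (∈-filter⁺ (_∈? F) x∈τ x∈F)
    case : Dec (e ∈ F) → ∃ λ c → IsChain c × SameSet (φ c) F × length c ≡ length F
    case (yes e∈F) = e ∷ us , ((λ ()) , linked) , same , φ-preimage-length linked uniq same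
      where
      same : SameSet (φ (e ∷ us)) F
      same = (λ x x∈ → to x (⊆τ x (subst (x ∈_) (φ-e∷ us) x∈))) ,
             (λ x x∈F → subst (x ∈_) (sym (φ-e∷ us)) (τ⊆ x (F-τ x∈F)))
        where
        to : ∀ x → x ∈ e ∷ filter (_∈? F) τ → x ∈ F
        to x (here refl) = e∈F
        to x (there x∈) = proj₂ (∈-filter⁻ (_∈? F) {xs = τ} x∈)
    -- The leading `e` of the chain is dropped, matching the filter in `φ`.
    case (no e∉F) = proper us linked ⊆τ τ⊆
      where
      proper : ∀ us → Linked _<β_ (e ∷ us) → φe (e ∷ us) ⊆ (e ∷ filter (_∈? F) τ) →
        (e ∷ filter (_∈? F) τ) ⊆ φe (e ∷ us) →
        ∃ λ c → IsChain c × SameSet (φ c) F × length c ≡ length F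
      -- With `e` alone in the chain, every element of `F` would be `e`, so `F` would be empty.
      proper [] _ _ τ⊆ = ⊥-elim (nonempty (empty F λ x x∈F → e∉F (subst (_∈ F) (φe-e (τ⊆ x (F-τ x∈F))) x∈F)))
        where
        φe-e : ∀ {x} → x ∈ φe (e ∷ []) → x ≡ e
        φe-e (here refl) = invʳ e
        empty : ∀ (xs : List W) → (∀ x → ¬ x ∈ xs) → xs ≡ []
        empty [] _ = refl
        empty (x ∷ _) none = contradiction (here refl) (none x)
      proper (u ∷ us) ((_ , e≢u) ∷ tail) ⊆τ τ⊆ = u ∷ us , ((λ ()) , tail) , same , φ-preimage-length tail uniq same
        where
        P? : ∀ x → Dec (x ≢ e)
        P? x = ¬? (x ≟ e)
        to : ∀ {x} → x ∈ e ∷ filter (_∈? F) τ → x ≢ e → x ∈ F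
        to (here x≡e) x≢e = contradiction x≡e x≢e
        to (there x∈) _ = proj₂ (∈-filter⁻ (_∈? F) {xs = τ} x∈)
        same : SameSet (φ (u ∷ us)) F
        same = (λ x x∈ → let x∈φe , x≢e = ∈-filter⁻ P? (subst (x ∈_) (φ-filter us (e≢u ∘ sym)) x∈) in to (⊆τ x x∈φe) x≢e) ,
               (λ x x∈F → subst (x ∈_) (sym (φ-filter us (e≢u ∘ sym)))
                 (∈-filter⁺ P? (τ⊆ x (F-τ x∈F)) λ { refl → e∉F x∈F }))


theorem6p1 : (C : CoxeterSystem) →
    (∀ c → Theory.IsChain C c → Theory.IsFaceΔ C (Theory.φ C c) × length (Theory.φ C c) ≡ length c)
    × (∀ c c′ → Theory.IsChain C c → Theory.IsChain C c′ →
    Theory.SameSet C (Theory.φ C c) (Theory.φ C c′) → c ≡ c′)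
    × (∀ F → Theory.IsFaceΔ C F →
    ∃ λ c → Theory.IsChain C c × Theory.SameSet C (Theory.φ C c) F × length c ≡ length F)
theorem6p1 C = face , injective , φ-surjective
  where
  open Theory C
  open Coxeter C
  face : ∀ c → IsChain c → IsFaceΔ (φ c) × length (φ c) ≡ length c
  face [] (nonempty , _) = contradiction refl nonempty
  face (_ ∷ _) (_ , linked) = φ-face linked , φ-length linked
  injective : ∀ c c′ → IsChain c → IsChain c′ → SameSet (φ c) (φ c′) → c ≡ c′
  injective [] _ (nonempty , _) _ _ = contradiction refl nonempty
  injective (_ ∷ _) [] _ (nonempty , _) _ = contradiction refl nonempty
  injective (_ ∷ _) (_ ∷ _) (_ , linked) (_ , linked′) same = φ-injective linked linked′ same
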